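{- Let $\sigma=\{R\}$ with $R$ binary, and let $\Phi=\mathsf{Split}\vee\mathsf{Diverse}$ be the fluted sentence defined in the context. Over finite structures, $\Phi$ is preserved under extensions (if $\mathfrak C\subseteq\mathfrak D$ are finite $\sigma$-structures and $\mathfrak C\models\Phi$, then $\mathfrak D\models\Phi$), but there is no existential fluted sentence $\psi\in\exists\mathsf{FL}[0](\sigma)$ that has the same truth value as $\Phi$ in every finite $\sigma$-structure.
   Context: All structures have non-empty domains; there is no equality in the language. $\mathfrak C\subseteq\mathfrak D$ means that $\mathfrak C$ is the induced substructure of $\mathfrak D$ on $C\subseteq D$; then $\mathfrak D$ is an extension of $\mathfrak C$. Existential fluted formulas. Fix variables $x_1,x_2,\ldots$. The existential levels $\exists\mathsf{FL}[m](\sigma)$, $m\ge0$, are defined by simultaneous induction: $\top,\bot\in\exists\mathsf{FL}[m](\sigma)$; for $R\in\sigma$ of arity $r\le m$, the suffix atom $R(x_{m-r+1},\ldots,x_m)$ and its negation are in $\exists\mathsf{FL}[m](\sigma)$; closure under $\wedge$ and $\vee$; if $\varphi\in\exists\mathsf{FL}[m+1](\sigma)$ then $\exists x_{m+1}\varphi\in\exists\mathsf{FL}[m](\sigma)$. There are no universal quantifiers. $\exists\mathsf{FL}[0](\sigma)$ is the set of existential fluted sentences. The sentence $\Phi$. Let $\mathsf Z(x_2):=\forall x_3\,\neg R(x_2,x_3)$, $\mathsf O(x_2):=\forall x_3\,R(x_2,x_3)$, $\mathsf M(x_2):=\exists x_3 R(x_2,x_3)\wedge\exists x_3\neg R(x_2,x_3)$,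 and $\mathsf M(x_1):=\exists x_2R(x_1,x_2)\wedge\exists x_2\neg R(x_1,x_2)$. For $\varepsilon\in\{0,1\}$ let $R^{1}(x_1,x_2):=R(x_1,x_2)$, $R^{0}(x_1,x_2):=\neg R(x_1,x_2)$, and for $T\in\{\mathsf Z,\mathsf O,\mathsf M\}$ let $E_{\varepsilon,T}(x_1):=\exists x_2(R^{\varepsilon}(x_1,x_2)\wedge T(x_2))$. Put $$\mathsf{Split}:=\bigvee_{T\in\{\mathsf Z,\mathsf O,\mathsf M\}}\exists x_1(E_{0,T}(x_1)\wedge E_{1,T}(x_1)),$$ $$\mathsf{Diverse}:=\bigvee_{\varepsilon\in\{0,1\},\,T\in\{\mathsf Z,\mathsf O,\mathsf M\}}\bigl[\exists x_1(\mathsf M(x_1)\wedge E_{\varepsilon,T}(x_1))\wedge\exists x_1(\mathsf M(x_1)\wedge\neg E_{\varepsilon,T}(x_1))\bigr],$$ $$\Phi:=\mathsf{Split}\vee\mathsf{Diverse}.$$ -}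

module Defs where

open import Data.Bool using (Bool; true; false)
open import Data.Empty using (⊥)
open import Data.Fin using (Fin)
open import Data.Nat using (ℕ; suc; _+_; _≤_; z≤n; s≤s)
open import Data.Product using (∃-syntax; _×_)
open import Data.Sum using (_⊎_)
open import Data.Unit using (⊤)
open import Data.Vec using (Vec; []; _∷_; map; reverse; truncate)
open import Function.Bundles using (_↔_; _⇔_)
open import Function.Definitions using (Injective)
open import Relation.Binary.PropositionalEquality using (_≡_)
open import Relation.Nullary using (¬_)
open import Relation.Unary using (Pred; Decidable)
open import Level using (0ℓ)

record Signature : Set₁ where
  field
    Sym : Set
    ar  : Sym → ℕ

open Signature

infix  8 ¬ᶠ_
infixr 7 _∧ᶠ_
infixr 6 _∨ᶠ_
infix  8 ∃ᶠ_ ∀ᶠ_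

-- FL σ m is level m of the fluted fragment: the free variables are among
-- x₁, …, x_m.  Variables are implicit: atom P stands for
-- P(x_{m-r+1}, …, x_m) with r = ar P, and a quantifier taking level m + 1 to
-- level m binds x_{m+1}.
data FL (σ : Signature) : ℕ → Set where
  ⊤ᶠ ⊥ᶠ     : ∀ {m} → FL σ m
  atom      : ∀ {m} (P : Sym σ) → ar σ P ≤ m → FL σ m
  ¬ᶠ_       : ∀ {m} → FL σ m → FL σ m
  _∧ᶠ_ _∨ᶠ_ : ∀ {m} → FL σ m → FL σ m → FL σ m
  ∃ᶠ_ ∀ᶠ_   : ∀ {m} → FL σ (suc m) → FL σ m

-- The set ∃FL[m](σ), as a predicate on fluted formulas of level m.
data ∃FL {σ : Signature} : (m : ℕ) → FL σ m → Set where
  ⊤∃    : ∀ {m} → ∃FL m ⊤ᶠ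
  ⊥∃    : ∀ {m} → ∃FL m ⊥ᶠ
  atom∃ : ∀ {m} (P : Sym σ) (r≤m : ar σ P ≤ m) → ∃FL m (atom P r≤m)
  natom∃ : ∀ {m} (P : Sym σ) (r≤m : ar σ P ≤ m) → ∃FL m (¬ᶠ atom P r≤m)
  _∧∃_  : ∀ {m φ ψ} → ∃FL m φ → ∃FL m ψ → ∃FL m (φ ∧ᶠ ψ)
  _∨∃_  : ∀ {m φ ψ} → ∃FL m φ → ∃FL m ψ → ∃FL m (φ ∨ᶠ ψ)
  ∃∃    : ∀ {m φ} → ∃FL (suc m) φ → ∃FL m (∃ᶠ φ)

-- The interpretations are required to be decidable so that, the domain being
-- finite, every formula has a truth value and the constructive reading of
-- satisfaction below agrees with the classical one.
record FiniteStructure (σ : Signature) : Set₁ where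
  field
    Carrier  : Set
    nonEmpty : Carrier
    finite   : ∃[ n ] (Carrier ↔ Fin n)
    rel      : (P : Sym σ) → Pred (Vec Carrier (ar σ P)) 0ℓ
    rel?     : (P : Sym σ) → Decidable (rel P)

open FiniteStructure

-- An assignment lists its values latest variable first, as x_m ∷ … ∷ x₁ ∷ [],
-- hence the reversal in the clause for atoms.
Sat : ∀ {σ m} (𝔇 : FiniteStructure σ) → FL σ m → Vec (Carrier 𝔇) m → Set
Sat 𝔇 ⊤ᶠ           ρ = ⊤
Sat 𝔇 ⊥ᶠ           ρ = ⊥
Sat 𝔇 (atom P r≤m) ρ = rel 𝔇 P (reverse (truncate r≤m ρ))
Sat 𝔇 (¬ᶠ φ)       ρ = ¬ Sat 𝔇 φ ρ
Sat 𝔇 (φ ∧ᶠ ψ)     ρ = Sat 𝔇 φ ρ × Sat 𝔇 ψ ρ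
Sat 𝔇 (φ ∨ᶠ ψ)     ρ = Sat 𝔇 φ ρ ⊎ Sat 𝔇 ψ ρ
Sat 𝔇 (∃ᶠ φ)       ρ = ∃[ d ] Sat 𝔇 φ (d ∷ ρ)
Sat 𝔇 (∀ᶠ φ)       ρ = ∀ d → Sat 𝔇 φ (d ∷ ρ)

infix 4 _⊨_ _⊆_

_⊨_ : ∀ {σ} → FiniteStructure σ → FL σ 0 → Set
𝔇 ⊨ φ = Sat 𝔇 φ []

-- Inclusion of an induced substructure, with the subset inclusion of domains
-- rendered as an injection.
record _⊆_ {σ} (ℭ 𝔇 : FiniteStructure σ) : Set where
  field
    incl      : Carrier ℭ → Carrier 𝔇
    injective : Injective _≡_ _≡_ incl
    induced   : ∀ P v → rel ℭ P v ⇔ rel 𝔇 P (map incl v)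

data Symbol : Set where
  R : Symbol

σ : Signature
σ = record { Sym = Symbol ; ar = λ { R → 2 } }

-- R(x_{m+1}, x_{m+2})
Rᶠ : ∀ {m} → FL σ (2 + m)
Rᶠ = atom R (s≤s (s≤s z≤n))

-- R¹ and R⁰, with true for 1 and false for 0.
R^ : ∀ {m} → Bool → FL σ (2 + m)
R^ true  = Rᶠ
R^ false = ¬ᶠ Rᶠ

-- Formulas in the single variable x_{m+1}: m = 0 gives the versions in x₁,
-- m = 1 those in x₂.
𝖹 𝖮 𝖬 : ∀ {m} → FL σ (suc m)
𝖹 = ∀ᶠ (¬ᶠ Rᶠ)
𝖮 = ∀ᶠ Rᶠ
𝖬 = (∃ᶠ Rᶠ) ∧ᶠ (∃ᶠ (¬ᶠ Rᶠ))

data RowType : Set where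
  Z O M : RowType

⟦_⟧ : ∀ {m} → RowType → FL σ (suc m)
⟦ Z ⟧ = 𝖹
⟦ O ⟧ = 𝖮
⟦ M ⟧ = 𝖬

E : Bool → RowType → FL σ 1
E ε T = ∃ᶠ (R^ ε ∧ᶠ ⟦ T ⟧)

⋁ε : ∀ {m} → (Bool → FL σ m) → FL σ m
⋁ε φ = φ false ∨ᶠ φ true

⋁T : ∀ {m} → (RowType → FL σ m) → FL σ m
⋁T φ = φ Z ∨ᶠ φ O ∨ᶠ φ M

Split Diverse Φ : FL σ 0
Split   = ⋁T λ T → ∃ᶠ (E false T ∧ᶠ E true T)
Diverse = ⋁ε λ ε → ⋁T λ T → (∃ᶠ (𝖬 ∧ᶠ E ε T)) ∧ᶠ (∃ᶠ (𝖬 ∧ᶠ ¬ᶠ E ε T))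
Φ       = Split ∨ᶠ Diverse

{-# OPTIONS --safe #-}
-- Φ fails exactly when all mixed elements have one common row, and this row is
-- constant on each of the classes Z, O and M ("uniformity").  Uniformity passes
-- to a substructure ℭ of 𝔇: if ℭ has a mixed element at all, then every mixed
-- element of 𝔇 lying in ℭ has the same row and so stays mixed, hence row types
-- in ℭ and 𝔇 agree.
--
-- Existential fluted formulas only see the edge between the last two variables,
-- so they are preserved by simulations of R together with its complement.  Take
-- 𝔄 = {a, z, z′} with the single edge a → z′ and 𝔅 = {b, c} with the single
-- edge b → c.  Then 𝔄 ⊨ Split at a, and Φ fails in 𝔅; but z, although of type Z,
-- can be simulated by the mixed b, so 𝔅 simulates 𝔄.
module Submission where

open import Defs
open import Data.Bool using (Bool; true; false; T; T?)
open import Data.Fin using (Fin; zero)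
open import Data.Fin.Patterns using (0F; 1F; 2F)
open import Data.Fin.Properties using (any?; all?)
open import Data.Nat using (suc; s≤s; z≤n)
open import Data.Product using (∃-syntax; _×_; _,_)
open import Data.Sum using (inj₁; inj₂)
open import Data.Unit using (tt)
open import Data.Vec using (Vec; []; _∷_; reverse; truncate)
open import Function.Base using (_∘_)
open import Function.Bundles using (_⇔_; Equivalence; Inverse)
open import Function.Construct.Identity using (↔-id; ⇔-id)
open import Level using (0ℓ)
open import Relation.Binary.PropositionalEquality using (_≡_; refl; sym; subst)
open import Relation.Nullary using (¬_; Dec; yes; no; contradiction; ¬?; _×-dec_; _⊎-dec_)
open import Relation.Nullary.Decidable using (map′; decidable-stable; from-yes; from-no)
open import Relation.Unary using (Pred; Decidable)

open FiniteStructure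

module _ {τ} (𝔇 : FiniteStructure τ) where

  ∃-dec : {P : Pred (Carrier 𝔇) 0ℓ} → Decidable P → Dec (∃[ d ] P d)
  ∃-dec {P} P? with _ , bij ← finite 𝔇 =
    map′ (λ (i , p) → from i , p)
         (λ (d , p) → to d , subst P (sym (strictlyInverseʳ d)) p)
         (any? (P? ∘ from))
    where open Inverse bij

  ∀-dec : {P : Pred (Carrier 𝔇) 0ℓ} → Decidable P → Dec (∀ d → P d)
  ∀-dec {P} P? with _ , bij ← finite 𝔇 =
    map′ (λ p d → subst P (strictlyInverseʳ d) (p (to d)))
         (λ p i → p (from i))
         (all? (P? ∘ from))
    where open Inverse bij

  -- Justifies the arguments by contradiction below and lets `Φ` be evaluated outright in `𝔄` and
  -- `𝔅`.
  Sat? : ∀ {m} (φ : FL τ m) → Decidable (Sat 𝔇 φ)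
  Sat? ⊤ᶠ           ρ = yes tt
  Sat? ⊥ᶠ           ρ = no λ ()
  Sat? (atom P r≤m) ρ = rel? 𝔇 P (reverse (truncate r≤m ρ))
  Sat? (¬ᶠ φ)       ρ = ¬? (Sat? φ ρ)
  Sat? (φ ∧ᶠ ψ)     ρ = Sat? φ ρ ×-dec Sat? ψ ρ
  Sat? (φ ∨ᶠ ψ)     ρ = Sat? φ ρ ⊎-dec Sat? ψ ρ
  Sat? (∃ᶠ φ)       ρ = ∃-dec λ d → Sat? φ (d ∷ ρ)
  Sat? (∀ᶠ φ)       ρ = ∀-dec λ d → Sat? φ (d ∷ ρ)

splitᶠ : RowType → FL σ 0
splitᶠ T = ∃ᶠ (E false T ∧ᶠ E true T)

diverseᶠ : Bool → RowType → FL σ 0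
diverseᶠ ε T = (∃ᶠ (𝖬 ∧ᶠ E ε T)) ∧ᶠ (∃ᶠ (𝖬 ∧ᶠ ¬ᶠ E ε T))

module _ (𝔇 : FiniteStructure σ) where

  ⋁ε-intro : (φ : Bool → FL σ 0) (ε : Bool) → 𝔇 ⊨ φ ε → 𝔇 ⊨ ⋁ε φ
  ⋁ε-intro φ false = inj₁
  ⋁ε-intro φ true  = inj₂

  ⋁ε-elim : (φ : Bool → FL σ 0) → 𝔇 ⊨ ⋁ε φ → ∃[ ε ] 𝔇 ⊨ φ ε
  ⋁ε-elim φ (inj₁ p) = false , p
  ⋁ε-elim φ (inj₂ p) = true  , p

  ⋁T-intro : (φ : RowType → FL σ 0) (T : RowType) → 𝔇 ⊨ φ T → 𝔇 ⊨ ⋁T φ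
  ⋁T-intro φ Z = inj₁
  ⋁T-intro φ O = inj₂ ∘ inj₁
  ⋁T-intro φ M = inj₂ ∘ inj₂

  ⋁T-elim : (φ : RowType → FL σ 0) → 𝔇 ⊨ ⋁T φ → ∃[ T ] 𝔇 ⊨ φ T
  ⋁T-elim φ (inj₁ p)        = Z , p
  ⋁T-elim φ (inj₂ (inj₁ p)) = O , p
  ⋁T-elim φ (inj₂ (inj₂ p)) = M , p

  infix 4 _⟶_ _∶_

  _⟶_ : Carrier 𝔇 → Carrier 𝔇 → Set
  x ⟶ y = rel 𝔇 R (x ∷ y ∷ [])

  _⟶?_ : ∀ x y → Dec (x ⟶ y)
  x ⟶? y = rel? 𝔇 R (x ∷ y ∷ [])

  -- An assignment-free form of `Sat 𝔇 ⟦ T ⟧`, so that matching on a proof reveals `T`.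
  data _∶_ (x : Carrier 𝔇) : RowType → Set where
    empty : (∀ y → ¬ x ⟶ y) → x ∶ Z
    full  : (∀ y → x ⟶ y) → x ∶ O
    mixed : ∀ {y z} → x ⟶ y → ¬ x ⟶ z → x ∶ M

  Sat⇒∶ : ∀ {m x} {ρ : Vec _ m} T → Sat 𝔇 ⟦ T ⟧ (x ∷ ρ) → x ∶ T
  Sat⇒∶ Z none                    = empty none
  Sat⇒∶ O all                     = full all
  Sat⇒∶ M ((_ , x⟶y) , (_ , x↛z)) = mixed x⟶y x↛z

  ∶⇒Sat : ∀ {m x T} {ρ : Vec _ m} → x ∶ T → Sat 𝔇 ⟦ T ⟧ (x ∷ ρ)
  ∶⇒Sat (empty none)    = none
  ∶⇒Sat (full all)      = all
  ∶⇒Sat (mixed x⟶y x↛z) = (_ , x⟶y) , (_ , x↛z)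

  rowType : ∀ x → ∃[ T ] x ∶ T
  rowType x with Sat? 𝔇 (∃ᶠ Rᶠ) (x ∷ []) | Sat? 𝔇 (∃ᶠ ¬ᶠ Rᶠ) (x ∷ [])
  ... | no ∄y         | _             = Z , empty λ y x⟶y → ∄y (y , x⟶y)
  ... | yes _         | no ∄z         =
    O , full λ z → decidable-stable (x ⟶? z) λ x↛z → ∄z (z , x↛z)
  ... | yes (_ , x⟶y) | yes (_ , x↛z) = M , mixed x⟶y x↛z

  rowType-unique : ∀ {x T T′} → x ∶ T → x ∶ T′ → T ≡ T′
  rowType-unique (empty _)     (empty _)     = refl
  rowType-unique (empty none)  (full all)    =
    contradiction (all (nonEmpty 𝔇)) (none (nonEmpty 𝔇))
  rowType-unique (empty none)  (mixed x⟶y _) = contradiction x⟶y (none _)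
  rowType-unique (full all)    (empty none)  =
    contradiction (all (nonEmpty 𝔇)) (none (nonEmpty 𝔇))
  rowType-unique (full _)      (full _)      = refl
  rowType-unique (full all)    (mixed _ x↛z) = contradiction (all _) x↛z
  rowType-unique (mixed x⟶y _) (empty none)  = contradiction x⟶y (none _)
  rowType-unique (mixed _ x↛z) (full all)    = contradiction (all _) x↛z
  rowType-unique (mixed _ _)   (mixed _ _)   = refl

  -- With `a = b`: a mixed row is constant on each type. With `x = y`: any two mixed rows agree.
  -- Non-edges transfer by contraposition, with the roles swapped.
  Uniform : Set
  Uniform = ∀ {a b x y T} → a ∶ M → b ∶ M → x ∶ T → y ∶ T → a ⟶ x → b ⟶ y

  ¬Φ⇒uniform : ¬ 𝔇 ⊨ Φ → Uniform
  ¬Φ⇒uniform ¬Φ {a} {b} {x} {y} {T} a∶M b∶M x∶T y∶T a⟶x =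
    decidable-stable (b ⟶? y) λ b↛y →
      let ¬split  = ¬Φ ∘ inj₁ ∘ ⋁T-intro splitᶠ T
          -- As `b` misses `y` of type `T`, an edge from `b` to any element of type `T` would be a
          -- split; hence `E true T` separates `a` from `b`.
          ¬E₁b    = λ E₁b → ¬split (b , (y , b↛y , ∶⇒Sat y∶T) , E₁b)
          diverse = (a , ∶⇒Sat {ρ = []} a∶M , (x , a⟶x , ∶⇒Sat x∶T)) , (b , ∶⇒Sat {ρ = []} b∶M , ¬E₁b)
      in ¬Φ (inj₂ (⋁ε-intro (⋁T ∘ diverseᶠ) true (⋁T-intro (diverseᶠ true) T diverse)))

  uniform⇒¬Φ : Uniform → ¬ 𝔇 ⊨ Φ
  uniform⇒¬Φ uni (inj₁ split)
    with T , _ , (_ , a↛x , x∶T) , (_ , a⟶y , y∶T) ← ⋁T-elim splitᶠ split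
    = a↛x (uni a∶M a∶M (Sat⇒∶ T y∶T) (Sat⇒∶ T x∶T) a⟶y)
    -- A splitting element has both an edge and a non-edge, so it is mixed and uniformity can
    -- compare it with itself.
    where a∶M = mixed a⟶y a↛x
  uniform⇒¬Φ uni (inj₂ diverse) with ⋁ε-elim (⋁T ∘ diverseᶠ) diverse
  ... | false , diverse₀
    with T , (_ , a∶M , (_ , a↛x , x∶ᶠT)) , (_ , b∶M , ¬E₀b) ← ⋁T-elim (diverseᶠ false) diverse₀
    = ¬E₀b (_ , a↛x ∘ uni (Sat⇒∶ {ρ = []} M b∶M) (Sat⇒∶ {ρ = []} M a∶M) x∶T x∶T , ∶⇒Sat x∶T)
    where x∶T = Sat⇒∶ T x∶ᶠT
  ... | true , diverse₁
    with T , (_ , a∶M , (_ , a⟶x , x∶ᶠT)) , (_ , b∶M , ¬E₁b) ← ⋁T-elim (diverseᶠ true) diverse₁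
    = ¬E₁b (_ , uni (Sat⇒∶ {ρ = []} M a∶M) (Sat⇒∶ {ρ = []} M b∶M) x∶T x∶T a⟶x , ∶⇒Sat x∶T)
    where x∶T = Sat⇒∶ T x∶ᶠT

module _ {ℭ 𝔇 : FiniteStructure σ} (ℭ⊆𝔇 : ℭ ⊆ 𝔇) where
  open _⊆_ ℭ⊆𝔇

  edge⁺ : ∀ {x y} → _⟶_ ℭ x y → _⟶_ 𝔇 (incl x) (incl y)
  edge⁺ = Equivalence.to (induced R _)

  edge⁻ : ∀ {x y} → _⟶_ 𝔇 (incl x) (incl y) → _⟶_ ℭ x y
  edge⁻ = Equivalence.from (induced R _)

  mixed⁺ : ∀ {x} → _∶_ ℭ x M → _∶_ 𝔇 (incl x) M
  mixed⁺ (mixed x⟶y x↛z) = mixed (edge⁺ x⟶y) (x↛z ∘ edge⁻)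

  -- Empty and full rows survive restriction. A mixed row in `𝔇` agrees with that of `a`, whose edge
  -- and non-edge both lie in `ℭ`.
  type⁻ : Uniform 𝔇 → ∀ {a x T} → _∶_ ℭ a M → _∶_ 𝔇 (incl x) T → _∶_ ℭ x T
  type⁻ uni _ (empty none) = empty λ y → none (incl y) ∘ edge⁺
  type⁻ uni _ (full all)   = full λ y → edge⁻ (all (incl y))
  type⁻ uni a∶M@(mixed {u} {v} a⟶u a↛v) x∶M@(mixed _ _)
    with _ , u∶T ← rowType 𝔇 (incl u) | _ , v∶T ← rowType 𝔇 (incl v) =
    mixed (edge⁻ (uni (mixed⁺ a∶M) x∶M u∶T u∶T (edge⁺ a⟶u)))
          (a↛v ∘ edge⁻ ∘ uni x∶M (mixed⁺ a∶M) v∶T v∶T ∘ edge⁺)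

  -- Follows from `type⁻`, since row types exist in `𝔇` and are unique in `ℭ`.
  type⁺ : Uniform 𝔇 → ∀ {a x T} → _∶_ ℭ a M → _∶_ ℭ x T → _∶_ 𝔇 (incl x) T
  type⁺ uni {x = x} a∶M x∶T with _ , x∶T′ ← rowType 𝔇 (incl x)
    with refl ← rowType-unique ℭ (type⁻ uni a∶M x∶T′) x∶T = x∶T′

  uniform-⊆ : Uniform 𝔇 → Uniform ℭ
  uniform-⊆ uni a∶M b∶M x∶T y∶T a⟶x =
    edge⁻ (uni (mixed⁺ a∶M) (mixed⁺ b∶M) (type⁺ uni a∶M x∶T) (type⁺ uni a∶M y∶T) (edge⁺ a⟶x))

Φ-preserved : ∀ (ℭ 𝔇 : FiniteStructure σ) → ℭ ⊆ 𝔇 → ℭ ⊨ Φ → 𝔇 ⊨ Φ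
Φ-preserved ℭ 𝔇 ℭ⊆𝔇 ℭ⊨Φ = decidable-stable (Sat? 𝔇 Φ []) λ 𝔇⊭Φ →
  uniform⇒¬Φ ℭ (uniform-⊆ ℭ⊆𝔇 (¬Φ⇒uniform 𝔇 𝔇⊭Φ)) ℭ⊨Φ

-- Only `forth` moves occur, to match existential quantifiers; the equivalence of edges serves
-- negated atoms.
record Simulation (𝔄 𝔅 : FiniteStructure σ) : Set₁ where
  infix 4 _≲_
  field
    _≲_   : Carrier 𝔄 → Carrier 𝔅 → Set
    total : ∀ x → ∃[ y ] x ≲ y
    forth : ∀ {x y} → x ≲ y → ∀ x′ →
            ∃[ y′ ] x′ ≲ y′ × (_⟶_ 𝔄 x x′ ⇔ _⟶_ 𝔅 y y′)

module _ {𝔄 𝔅 : FiniteStructure σ} (sim : Simulation 𝔄 𝔅) where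
  open Simulation sim

  -- Atoms see just the last two variables, so older values are left unrelated.
  data Matched : ∀ {m} → Vec (Carrier 𝔄) m → Vec (Carrier 𝔅) m → Set where
    []   : Matched [] []
    [_]  : ∀ {x y} → x ≲ y → Matched (x ∷ []) (y ∷ [])
    edge : ∀ {m x x′ y y′} {ρ : Vec _ m} {ρ′ : Vec _ m} →
           x′ ≲ y′ → (_⟶_ 𝔄 x x′ ⇔ _⟶_ 𝔅 y y′) →
           Matched (x′ ∷ x ∷ ρ) (y′ ∷ y ∷ ρ′)

  extend : ∀ {m} {ρ : Vec _ m} {ρ′} → Matched ρ ρ′ →
           ∀ x → ∃[ y ] Matched (x ∷ ρ) (y ∷ ρ′)
  extend []         x with y , x≲y ← total x        = y , [ x≲y ]
  extend [ s ]      x with y , x≲y , eq ← forth s x = y , edge x≲y eq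
  extend (edge s _) x with y , x≲y , eq ← forth s x = y , edge x≲y eq

  ∃FL-preserved : ∀ {m φ} {ρ : Vec _ m} {ρ′} → ∃FL m φ → Matched ρ ρ′ →
                  Sat 𝔄 φ ρ → Sat 𝔅 φ ρ′
  ∃FL-preserved ⊤∃ _ _ = tt
  -- Matching the arity bound forces level at least two, leaving `edge` as the only case.
  ∃FL-preserved (atom∃ R (s≤s (s≤s z≤n))) (edge _ eq) = Equivalence.to eq
  ∃FL-preserved (natom∃ R (s≤s (s≤s z≤n))) (edge _ eq) ¬r = ¬r ∘ Equivalence.from eq
  ∃FL-preserved (p ∧∃ q) s (a , b) = ∃FL-preserved p s a , ∃FL-preserved q s b
  ∃FL-preserved (p ∨∃ q) s (inj₁ a) = inj₁ (∃FL-preserved p s a)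
  ∃FL-preserved (p ∨∃ q) s (inj₂ b) = inj₂ (∃FL-preserved q s b)
  ∃FL-preserved (∃∃ p) s (x , a) with y , s′ ← extend s x = y , ∃FL-preserved p s′ a

finStructure : ∀ {n} → (Fin (suc n) → Fin (suc n) → Bool) → FiniteStructure σ
finStructure {n} r = record
  { Carrier  = Fin (suc n)
  ; nonEmpty = zero
  ; finite   = suc n , ↔-id _
  ; rel      = λ { R (x ∷ y ∷ []) → T (r x y) }
  ; rel?     = λ { R (x ∷ y ∷ []) → T? (r x y) }
  }

-- a, z, z′ are 0, 1, 2 in 𝔄, and b, c are 0, 1 in 𝔅.
𝔄 𝔅 : FiniteStructure σ
𝔄 = finStructure {2} λ { 0F 2F → true ; _ _ → false }
𝔅 = finStructure {1} λ { 0F 1F → true ; _ _ → false }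

𝔄⊨Φ : 𝔄 ⊨ Φ
𝔄⊨Φ = from-yes (Sat? 𝔄 Φ [])

𝔅⊭Φ : ¬ 𝔅 ⊨ Φ
𝔅⊭Φ = from-no (Sat? 𝔅 Φ [])

𝔅-simulates-𝔄 : Simulation 𝔄 𝔅
𝔅-simulates-𝔄 = record
  { _≲_   = _≲_
  ; total = λ x → 0F , b x
  ; forth = forth
  }
  where
  data _≲_ : Fin 3 → Fin 2 → Set where
    b : ∀ x → x ≲ 0F
    c : 2F ≲ 1F

  forth : ∀ {x y} → x ≲ y → ∀ x′ → ∃[ y′ ] x′ ≲ y′ × (_⟶_ 𝔄 x x′ ⇔ _⟶_ 𝔅 y y′)
  forth (b 0F) 0F = 0F , b 0F , ⇔-id _
  forth (b 0F) 1F = 0F , b 1F , ⇔-id _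
  -- The one edge of `𝔄` is answered by the one edge of `𝔅`. All other moves are non-edges, answered
  -- by moving to `0F`, which has no incoming edge.
  forth (b 0F) 2F = 1F , c    , ⇔-id _
  forth (b 1F) x′ = 0F , b x′ , ⇔-id _
  forth (b 2F) x′ = 0F , b x′ , ⇔-id _
  forth c      x′ = 0F , b x′ , ⇔-id _

corollary4p9 : (∀ (ℭ 𝔇 : FiniteStructure σ) → ℭ ⊆ 𝔇 → ℭ ⊨ Φ → 𝔇 ⊨ Φ)
    × ¬ (∃[ ψ ] (∃FL {σ} 0 ψ × (∀ (𝔇 : FiniteStructure σ) → (𝔇 ⊨ ψ) ⇔ (𝔇 ⊨ Φ))))
corollary4p9 = Φ-preserved , λ (ψ , ψ∃ , ψ⇔Φ) →
  𝔅⊭Φ (Equivalence.to (ψ⇔Φ 𝔅)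
    (∃FL-preserved 𝔅-simulates-𝔄 ψ∃ [] (Equivalence.from (ψ⇔Φ 𝔄) 𝔄⊨Φ)))
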